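{- Let $K$ denote the class of BALFIs $\mathbf{A}=\langle A,\wedge,\vee,\to,\neg,\circ,0,1\rangle$ such that $\neg a={\sim}a$ and $\circ a=1$ for every $a\in A$. Then the following varieties all coincide with $K$, and hence with one another: $$\mathsf{BI}(\mathrm{cl},\mathrm{ca}_\vee)=\mathsf{BI}(d1,\mathrm{ca}_\to)=\mathsf{BI}(\mathrm{cl},\mathrm{ca}_\to)=\mathsf{BI}(\mathrm{ciw},\mathrm{ca}_\to)=\mathsf{BI}(\mathrm{ci},\mathrm{ca}_\to)=\mathsf{BI}(i1,\mathrm{ca}_\to)=K.$$
   Context: A BALFI (Boolean algebra with LFI operators) is an algebra $\mathbf{B}=\langle B,\wedge,\vee,\to,\neg,\circ,0,1\rangle$, with unary operations $\neg,\circ$, such that $\langle B,\wedge,\vee,\to,0,1\rangle$ is a Boolean algebra and, for every $a\in B$, $a\vee\neg a=1$ and $a\wedge\neg a\wedge\circ a=0$. The Boolean complement is denoted ${\sim}a$ (in general $\neg a\neq{\sim}a$). $\mathsf{BI}(Ax_1,Ax_2)$ is the class of all BALFIs satisfying, for all elements $a,b$, the equations corresponding to $Ax_1$ and $Ax_2$, where: - $(\mathrm{ciw})$: $\circ a={\sim}(a\wedge\neg a)$; - $(\mathrm{ci})$: $\neg(\circ a)=a\wedge\neg a$; - $(\mathrm{cl})$: $\circ a=\neg(a\wedge\neg a)$; - $(d1)$: $\circ a\vee a=1$; - $(i1)$: $\neg(\circ a)\wedge a=\neg(\circ a)$; - $(\mathrm{ca}_\#)$, for $\#\in\{\wedge,\vee,\to\}$: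 $(\circ a\wedge\circ b)\wedge\circ(a\# b)=\circ a\wedge\circ b$. -}

module Defs where

open import Level using (Level; _⊔_) renaming (suc to lsuc)
open import Algebra.Core using (Op₁; Op₂)
open import Algebra.Definitions using (Congruent₁)
open import Algebra.Lattice.Structures using (IsBooleanAlgebra)
open import Data.Product.Base using (_×_)
open import Relation.Binary.Core using (Rel)
open import Relation.Unary using (Pred; _∩_)

-- The signature has implication but no Boolean complement: the complement
-- ∼ a is the term a ⇒ 0#, and ⇒ is tied to the lattice operations by ⇒-def.
-- ¬_ is the paraconsistent negation, distinct from ∼_ in general.
-- The trivial algebra (0# ≈ 1#) is allowed.
record BALFI (c ℓ : Level) : Set (lsuc (c ⊔ ℓ)) where
  infix  8 ¬_ ∘_ ∼_
  infixr 7 _∧_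
  infixr 6 _∨_
  infixr 5 _⇒_
  infix  4 _≈_
  field
    Carrier : Set c
    _≈_     : Rel Carrier ℓ
    _∧_     : Op₂ Carrier
    _∨_     : Op₂ Carrier
    _⇒_     : Op₂ Carrier
    ¬_      : Op₁ Carrier
    ∘_      : Op₁ Carrier
    0#      : Carrier
    1#      : Carrier

  ∼_ : Op₁ Carrier
  ∼ a = a ⇒ 0#

  field
    isBooleanAlgebra : IsBooleanAlgebra _≈_ _∨_ _∧_ ∼_ 1# 0#
    ⇒-def            : ∀ a b → a ⇒ b ≈ ∼ a ∨ b
    ¬-cong           : Congruent₁ _≈_ ¬_
    ∘-cong           : Congruent₁ _≈_ ∘_
    ∨-¬              : ∀ a → a ∨ ¬ a ≈ 1#
    ∧-¬-∘            : ∀ a → a ∧ ¬ a ∧ ∘ a ≈ 0#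

module _ {c ℓ : Level} where

  ciw ci cl d1 i1 : Pred (BALFI c ℓ) (c ⊔ ℓ)
  ciw A = ∀ a → ∘ a ≈ ∼ (a ∧ ¬ a)         where open BALFI A
  ci  A = ∀ a → ¬ (∘ a) ≈ a ∧ ¬ a         where open BALFI A
  cl  A = ∀ a → ∘ a ≈ ¬ (a ∧ ¬ a)         where open BALFI A
  d1  A = ∀ a → ∘ a ∨ a ≈ 1#              where open BALFI A
  i1  A = ∀ a → ¬ (∘ a) ∧ a ≈ ¬ (∘ a)     where open BALFI A

  ca : ((A : BALFI c ℓ) → Op₂ (BALFI.Carrier A)) → Pred (BALFI c ℓ) (c ⊔ ℓ)
  ca op A = ∀ a b → (∘ a ∧ ∘ b) ∧ ∘ (a # b) ≈ ∘ a ∧ ∘ b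
    where
    open BALFI A
    _#_ : Op₂ Carrier
    _#_ = op A

  ca∧ ca∨ ca⇒ : Pred (BALFI c ℓ) (c ⊔ ℓ)
  ca∧ = ca BALFI._∧_
  ca∨ = ca BALFI._∨_
  ca⇒ = ca BALFI._⇒_

BI : (c ℓ : Level) (Ax₁ Ax₂ : Pred (BALFI c ℓ) (c ⊔ ℓ)) → Pred (BALFI c ℓ) (c ⊔ ℓ)
BI c ℓ Ax₁ Ax₂ = Ax₁ ∩ Ax₂

K : (c ℓ : Level) → Pred (BALFI c ℓ) (c ⊔ ℓ)
K c ℓ A = ∀ a → (¬ a ≈ ∼ a) × (∘ a ≈ 1#)
  where open BALFI A

{-# OPTIONS --safe #-}

-- Each pair of axioms forces ∘ a ≈ 1# for every a, and then ¬ a is a complement of a.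
-- Each of cl, ciw, ci and i1 gives d1, that is, ∼ a ≤ ∘ a; it remains to get
-- a ≤ ∘ a (or a ∧ ¬ a ≤ ∘ a when (a ∧ ¬ a) ∨ ∘ a ≈ 1#).
-- For ca⇒: a ≈ ∼ a ⇒ 0#, with ∘ 0# ≈ 1# and a ≤ ∘ ∼ a, both by d1.
-- For ca∨: a ≈ (a ∧ ¬ a) ∨ (a ∧ ∘ a) is a disjoint join, where cl gives
-- ∘ (a ∧ ¬ a) ≈ 1#, and d1 gives a ∧ ¬ a ≤ ∘ (a ∧ ∘ a).
module Submission where

open import Defs
open import Level using (Level)
open import Algebra.Core using (Op₂)
open import Algebra.Lattice.Bundles using (BooleanAlgebra)
import Algebra.Lattice.Properties.BooleanAlgebra as BooleanAlgebraProperties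
open import Data.Product.Base using (_×_; _,_; proj₁; proj₂)
import Relation.Binary.Lattice as OrderTheoretic
import Relation.Binary.Lattice.Properties.JoinSemilattice as JoinSemilatticeProperties
import Relation.Binary.Reasoning.PartialOrder as PosetReasoning
open import Relation.Unary using (Pred; _≐_)
open import Relation.Unary.Properties using (≐-sym; ≐-trans)

module BALFIProperties {c ℓ : Level} (A : BALFI c ℓ) where
  open BALFI A

  booleanAlgebra : BooleanAlgebra c ℓ
  booleanAlgebra = record { isBooleanAlgebra = isBooleanAlgebra }

  open BooleanAlgebra booleanAlgebra
    using ( sym; trans; ∧-comm; ∧-assoc; ∨-comm; ∧-congˡ; ∧-congʳ; ∨-congˡ; ∨-congʳ
          ; ∨-complementˡ; ∨-complementʳ; ∧-complementˡ; ∧-complementʳ; ∧-distribˡ-∨)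
    renaming (¬-cong to ∼-cong)
  open BooleanAlgebraProperties booleanAlgebra
    using ( ∧-identityˡ; ∧-identityʳ; ∧-zeroˡ; ∨-identityˡ; ∨-identityʳ; ∨-zeroˡ
          ; poset; ∨-∧-orderTheoreticLattice)
    renaming (¬⊥≈⊤ to ∼0≈1; ¬⊤≈⊥ to ∼1≈0; ¬-involutive to ∼-involutive)
  open OrderTheoretic.Lattice ∨-∧-orderTheoreticLattice
    using (_≤_; antisym; reflexive; x∧y≤x; x∧y≤y; ∧-greatest; joinSemilattice)
    renaming (refl to ≤-refl; trans to ≤-trans)
  open JoinSemilatticeProperties joinSemilattice using (∨-monotonic; x≤y⇒x∨y≈y)
  open PosetReasoning poset

  ≤1 : ∀ x → x ≤ 1#
  ≤1 x = sym (∧-identityʳ x)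

  ∨≈1-monoˡ : ∀ {x y z} → x ≤ z → x ∨ y ≈ 1# → z ∨ y ≈ 1#
  ∨≈1-monoˡ x≤z x∨y≈1 =
    antisym (≤1 _) (≤-trans (reflexive (sym x∨y≈1)) (∨-monotonic x≤z ≤-refl))

  ≤∧∨≈1⇒≈1 : ∀ {x y} → x ≤ y → x ∨ y ≈ 1# → y ≈ 1#
  ≤∧∨≈1⇒≈1 x≤y x∨y≈1 = trans (sym (x≤y⇒x∨y≈y x≤y)) x∨y≈1

  -- Meet `x` with the cover `z ∨ y` of `1#`: the part inside `y` vanishes. With `d1` as the cover,
  -- anything disjoint from an element lies below the `∘` of that element.
  ∧≈0∧∨≈1⇒≤ : ∀ {x y z} → x ∧ y ≈ 0# → z ∨ y ≈ 1# → x ≤ z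
  ∧≈0∧∨≈1⇒≤ {x} {y} {z} x∧y≈0 z∨y≈1 = begin
    x              ≈⟨ ∧-identityʳ x ⟨
    x ∧ 1#         ≈⟨ ∧-congˡ z∨y≈1 ⟨
    x ∧ (z ∨ y)    ≈⟨ ∧-distribˡ-∨ x z y ⟩
    x ∧ z ∨ x ∧ y  ≈⟨ ∨-congˡ x∧y≈0 ⟩
    x ∧ z ∨ 0#     ≈⟨ ∨-identityʳ (x ∧ z) ⟩
    x ∧ z          ≤⟨ x∧y≤y x z ⟩
    z              ∎

  ¬0≈1 : ¬ 0# ≈ 1#
  ¬0≈1 = trans (sym (∨-identityˡ (¬ 0#))) (∨-¬ 0#)

  ∧-¬-∘-assoc : ∀ a → (a ∧ ¬ a) ∧ ∘ a ≈ 0#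
  ∧-¬-∘-assoc a = trans (∧-assoc a (¬ a) (∘ a)) (∧-¬-∘ a)

  -- Excluded middle for `¬` at `a ∧ ¬ a`, whose negation is `∘ a` by `cl`. This sharpens `d1`,
  -- where `a` stands in place of `a ∧ ¬ a`.
  cl⇒∨≈1 : cl A → ∀ a → (a ∧ ¬ a) ∨ ∘ a ≈ 1#
  cl⇒∨≈1 h a = trans (∨-congˡ (h a)) (∨-¬ (a ∧ ¬ a))

  cl⇒d1 : cl A → d1 A
  cl⇒d1 h a = trans (∨-comm (∘ a) a) (∨≈1-monoˡ (x∧y≤x a (¬ a)) (cl⇒∨≈1 h a))

  ciw⇒d1 : ciw A → d1 A
  ciw⇒d1 h a = trans (∨-comm (∘ a) a)
    (∨≈1-monoˡ (x∧y≤x a (¬ a)) (trans (∨-congˡ (h a)) (∨-complementʳ (a ∧ ¬ a))))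

  -- Excluded middle at `∘ a`, with `¬ (∘ a)` enlarged to `a`. Both `ci` and `i1` supply the bound.
  ¬∘≤⇒d1 : (∀ a → ¬ (∘ a) ≤ a) → d1 A
  ¬∘≤⇒d1 h a = trans (∨-comm (∘ a) a)
    (∨≈1-monoˡ (h a) (trans (∨-comm (¬ (∘ a)) (∘ a)) (∨-¬ (∘ a))))

  ci⇒d1 : ci A → d1 A
  ci⇒d1 h = ¬∘≤⇒d1 λ a → ≤-trans (reflexive (h a)) (x∧y≤x a (¬ a))

  i1⇒d1 : i1 A → d1 A
  i1⇒d1 h = ¬∘≤⇒d1 λ a → sym (h a)

  d1∧ca⇒⇒∘≈1 : d1 A → ca⇒ A → ∀ a → ∘ a ≈ 1#
  d1∧ca⇒⇒∘≈1 hd hca a = ≤∧∨≈1⇒≈1 a≤∘a (trans (∨-comm a (∘ a)) (hd a))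
    where
    ∘0≈1 : ∘ 0# ≈ 1#
    ∘0≈1 = trans (sym (∨-identityʳ (∘ 0#))) (hd 0#)

    a≤∘a : a ≤ ∘ a
    a≤∘a = begin
      a                                     ≤⟨ ∧≈0∧∨≈1⇒≤ (∧-complementʳ a) (hd (∼ a)) ⟩
      ∘ ∼ a                                 ≈⟨ ∧-identityʳ (∘ ∼ a) ⟨
      ∘ ∼ a ∧ 1#                            ≈⟨ ∧-congˡ ∘0≈1 ⟨
      ∘ ∼ a ∧ ∘ 0#                          ≈⟨ hca (∼ a) 0# ⟨
      (∘ ∼ a ∧ ∘ 0#) ∧ ∘ (∼ a ⇒ 0#)         ≤⟨ x∧y≤y _ _ ⟩
      -- `∼ a ⇒ 0#` is `∼ ∼ a` by definition, so double complementation returns to `a`.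
      ∘ (∼ a ⇒ 0#)                          ≈⟨ ∘-cong (∼-involutive a) ⟩
      ∘ a                                   ∎

  cl∧ca∨⇒∘≈1 : cl A → ca∨ A → ∀ a → ∘ a ≈ 1#
  cl∧ca∨⇒∘≈1 hcl hca a = ≤∧∨≈1⇒≈1 p≤∘a (cl⇒∨≈1 hcl a)
    where
    p q : Carrier
    p = a ∧ ¬ a
    q = a ∧ ∘ a

    -- By `cl`, `¬ p` is `∘ a`, so the axiom `∧-¬-∘` at `a` makes `p` consistent.
    p∧¬p≈0 : p ∧ ¬ p ≈ 0#
    p∧¬p≈0 = trans (∧-congˡ (sym (hcl a))) (∧-¬-∘-assoc a)

    ∘p≈1 : ∘ p ≈ 1#
    ∘p≈1 = trans (hcl p) (trans (¬-cong p∧¬p≈0) ¬0≈1)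

    p∨q≈a : p ∨ q ≈ a
    p∨q≈a = begin-equality
      a ∧ ¬ a ∨ a ∧ ∘ a    ≈⟨ ∧-distribˡ-∨ a (¬ a) (∘ a) ⟨
      -- The cover `(a ∧ ¬ a) ∨ ∘ a` of `1#` still covers when `a ∧ ¬ a` grows to `¬ a`.
      a ∧ (¬ a ∨ ∘ a)      ≈⟨ ∧-congˡ (∨≈1-monoˡ (x∧y≤y a (¬ a)) (cl⇒∨≈1 hcl a)) ⟩
      a ∧ 1#               ≈⟨ ∧-identityʳ a ⟩
      a                    ∎

    p∧q≈0 : p ∧ q ≈ 0#
    -- `p ∧ q` lies below both `a ∧ ¬ a` and `∘ a`, which are disjoint.
    p∧q≈0 = antisym
      (≤-trans (∧-greatest (x∧y≤x p q) (≤-trans (x∧y≤y p q) (x∧y≤y a (∘ a))))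
               (reflexive (∧-¬-∘-assoc a)))
      (sym (∧-zeroˡ (p ∧ q)))

    p≤∘a : p ≤ ∘ a
    p≤∘a = begin
      p                            ≤⟨ ∧≈0∧∨≈1⇒≤ p∧q≈0 (cl⇒d1 hcl q) ⟩
      ∘ q                          ≈⟨ ∧-identityˡ (∘ q) ⟨
      1# ∧ ∘ q                     ≈⟨ ∧-congʳ ∘p≈1 ⟨
      ∘ p ∧ ∘ q                    ≈⟨ hca p q ⟨
      (∘ p ∧ ∘ q) ∧ ∘ (p ∨ q)      ≤⟨ x∧y≤y _ _ ⟩
      ∘ (p ∨ q)                    ≈⟨ ∘-cong p∨q≈a ⟩
      ∘ a                          ∎

  ∘≈1⇒∧-¬≈0 : ∀ {a} → ∘ a ≈ 1# → a ∧ ¬ a ≈ 0#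
  ∘≈1⇒∧-¬≈0 {a} ∘a≈1 = begin-equality
    a ∧ ¬ a            ≈⟨ ∧-identityʳ (a ∧ ¬ a) ⟨
    (a ∧ ¬ a) ∧ 1#     ≈⟨ ∧-congˡ ∘a≈1 ⟨
    (a ∧ ¬ a) ∧ ∘ a    ≈⟨ ∧-¬-∘-assoc a ⟩
    0#                 ∎

  -- Uniqueness of Boolean complements: `¬ a` always joins with `a` to `1#`, and once `∘ a` is `1#`
  -- it is also disjoint from `a`.
  ∘≈1⇒K : (∀ a → ∘ a ≈ 1#) → K c ℓ A
  ∘≈1⇒K h a = antisym
      (∧≈0∧∨≈1⇒≤ (trans (∧-comm (¬ a) a) (∘≈1⇒∧-¬≈0 (h a))) (∨-complementˡ a))
      (∧≈0∧∨≈1⇒≤ (∧-complementˡ a) (trans (∨-comm (¬ a) a) (∨-¬ a)))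
    , h a

  module _ (hK : K c ℓ A) where

    K⇒∧-¬≈0 : ∀ a → a ∧ ¬ a ≈ 0#
    K⇒∧-¬≈0 a = ∘≈1⇒∧-¬≈0 (proj₂ (hK a))

    K⇒¬∘≈0 : ∀ a → ¬ (∘ a) ≈ 0#
    K⇒¬∘≈0 a = trans (¬-cong (proj₂ (hK a))) (trans (proj₁ (hK 1#)) ∼1≈0)

    K⇒ciw : ciw A
    K⇒ciw a = trans (proj₂ (hK a)) (sym (trans (∼-cong (K⇒∧-¬≈0 a)) ∼0≈1))

    K⇒ci : ci A
    K⇒ci a = trans (K⇒¬∘≈0 a) (sym (K⇒∧-¬≈0 a))

    K⇒cl : cl A
    K⇒cl a = trans (proj₂ (hK a)) (sym (trans (¬-cong (K⇒∧-¬≈0 a)) ¬0≈1))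

    K⇒d1 : d1 A
    K⇒d1 a = trans (∨-congʳ (proj₂ (hK a))) (∨-zeroˡ a)

    K⇒i1 : i1 A
    K⇒i1 a = trans (∧-congʳ (K⇒¬∘≈0 a)) (trans (∧-zeroˡ a) (sym (K⇒¬∘≈0 a)))

    -- The third factor is `1#` whatever element `op` produces, so one argument serves every
    -- connective.
    K⇒ca : (op : (B : BALFI c ℓ) → Op₂ (BALFI.Carrier B)) → ca op A
    K⇒ca op a b = trans (∧-congˡ (proj₂ (hK (op A a b)))) (∧-identityʳ (∘ a ∧ ∘ b))

module _ {c ℓ : Level} where
  open BALFIProperties

  cl∧ca∨≐K : BI c ℓ cl ca∨ ≐ K c ℓ
  cl∧ca∨≐K = (λ {A} (hcl , hca) → ∘≈1⇒K A (cl∧ca∨⇒∘≈1 A hcl hca))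
           , (λ {A} hK → K⇒cl A hK , K⇒ca A hK BALFI._∨_)

  -- Five of the six varieties differ only in the first axiom, so it suffices that this axiom
  -- implies `d1` and holds throughout `K`.
  Ax∧ca⇒≐K : {Ax : Pred (BALFI c ℓ) _} → (∀ A → Ax A → d1 A) → (∀ A → K c ℓ A → Ax A) →
             BI c ℓ Ax ca⇒ ≐ K c ℓ
  Ax∧ca⇒≐K Ax⇒d1 K⇒Ax =
      (λ {A} (hAx , hca) → ∘≈1⇒K A (d1∧ca⇒⇒∘≈1 A (Ax⇒d1 A hAx) hca))
    , (λ {A} hK → K⇒Ax A hK , K⇒ca A hK BALFI._⇒_)

proposition3p17 : (c ℓ : Level) →
    (BI c ℓ cl ca∨ ≐ BI c ℓ d1 ca⇒)
    × (BI c ℓ d1 ca⇒ ≐ BI c ℓ cl ca⇒)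
    × (BI c ℓ cl ca⇒ ≐ BI c ℓ ciw ca⇒)
    × (BI c ℓ ciw ca⇒ ≐ BI c ℓ ci ca⇒)
    × (BI c ℓ ci ca⇒ ≐ BI c ℓ i1 ca⇒)
    × (BI c ℓ i1 ca⇒ ≐ K c ℓ)
proposition3p17 c ℓ =
    -- Neighbouring varieties are compared through `K`.
    ≐-trans cl∧ca∨≐K (≐-sym d1≐K)
  , ≐-trans d1≐K (≐-sym cl≐K)
  , ≐-trans cl≐K (≐-sym ciw≐K)
  , ≐-trans ciw≐K (≐-sym ci≐K)
  , ≐-trans ci≐K (≐-sym i1≐K)
  , i1≐K
  where
  open BALFIProperties

  d1≐K : BI c ℓ d1 ca⇒ ≐ K c ℓ
  d1≐K = Ax∧ca⇒≐K (λ _ h → h) K⇒d1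

  cl≐K : BI c ℓ cl ca⇒ ≐ K c ℓ
  cl≐K = Ax∧ca⇒≐K cl⇒d1 K⇒cl

  ciw≐K : BI c ℓ ciw ca⇒ ≐ K c ℓ
  ciw≐K = Ax∧ca⇒≐K ciw⇒d1 K⇒ciw

  ci≐K : BI c ℓ ci ca⇒ ≐ K c ℓ
  ci≐K = Ax∧ca⇒≐K ci⇒d1 K⇒ci

  i1≐K : BI c ℓ i1 ca⇒ ≐ K c ℓ
  i1≐K = Ax∧ca⇒≐K i1⇒d1 K⇒i1
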